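{- For all integers $r,s\geq 1$, the grid $R_{r,s}$ satisfies $$\mathrm{gpn}(R_{r,s})=2\binom{r+s+2}{r+1}-2r-2s-4-\frac{rs}{2}\,(r+s+4).$$
   Context: For distinct vertices $u,v$ of a connected simple graph $G$, $\mathrm{gpn}_G(u,v)$ denotes the number of shortest $u$–$v$ paths in $G$, and for a graph $G$ on $n$ vertices $\mathrm{gpn}(G)=\sum_{\{u,v\}\subseteq V(G),\,u\neq v}\mathrm{gpn}_G(u,v)+n$ (sum over unordered pairs of distinct vertices). $R_{r,s}=P_r\,\square\,P_s$ is the Cartesian product of the paths $P_r$ and $P_s$ on $r$ and $s$ vertices; it has vertex set $\{1,\ldots,r\}\times\{1,\ldots,s\}$, with $(a,b)$ and $(x,y)$ adjacent if and only if $|a-x|+|b-y|=1$, and has $rs$ vertices. -}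

module Defs where

open import Data.Fin using (Fin; toℕ)
open import Data.Fin.Properties using (injective⇒≤)
import Data.Fin.Properties as Fin
open import Data.Integer using (+_)
open import Data.List using (List; []; _∷_; _++_; map; concatMap; filter; length; lookup;
  head; last; upTo; allFin; cartesianProduct; cartesianProductWith)
open import Data.List.Membership.Propositional using (_∈_; lose)
open import Data.List.Membership.Propositional.Properties using (∈-lookup; ∈-allFin;
  ∈-cartesianProduct⁺; ∈-cartesianProductWith⁺; ∈-concatMap⁺; ∈-filter⁺; ∈-filter⁻; ∈-upTo⁺)
open import Data.List.Relation.Unary.All as All using (All; all?)
open import Data.List.Relation.Unary.AllPairs using ([]; _∷_; allPairs?)
open import Data.List.Relation.Unary.Any using (here; index)
open import Data.List.Relation.Unary.Any.Properties using (lookup-index)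
open import Data.List.Relation.Unary.Linked using (Linked; linked?)
open import Data.List.Relation.Unary.Unique.Propositional using (Unique)
open import Data.List.Relation.Unary.Unique.Propositional.Properties using (allFin⁺; cartesianProduct⁺)
import Data.Maybe.Properties as Maybe
open import Data.Maybe using (just)
open import Data.Nat using (ℕ; zero; suc; _+_; _≤_; _≤?_; s≤s; ∣_-_∣)
open import Data.Nat.Properties using (∣-∣-comm; ∣n-n∣≡0)
open import Data.Nat.ListAction using (sum)
import Data.Nat.Properties as ℕ
open import Data.Product using (_×_; _,_; proj₂)
open import Data.Product.Properties using (≡-dec)
open import Data.Rational using (ℚ; _/_)
open import Data.Sum using (_⊎_; inj₁; inj₂)
open import Relation.Binary.Definitions using (Decidable; DecidableEquality; Symmetric; Irreflexive)
open import Relation.Binary.PropositionalEquality using (_≡_; refl; sym; trans; cong)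
open import Relation.Nullary using (contradiction; ¬?; map′; _×-dec_; _⊎-dec_)
import Relation.Unary as Unary

-- A finite simple graph; `vertices` lists every vertex exactly once.
record Graph : Set₁ where
  infix 4 _~_ _~?_ _≟_
  field
    Vertex            : Set
    _~_               : Vertex → Vertex → Set
    ~-sym             : Symmetric _~_
    ~-irrefl          : Irreflexive _≡_ _~_
    _~?_              : Decidable _~_
    _≟_               : DecidableEquality Vertex
    vertices          : List Vertex
    vertices-complete : ∀ v → v ∈ vertices
    vertices-unique   : Unique vertices

  order : ℕ
  order = length vertices

pathGraph : ℕ → Graph
pathGraph n = record
  { Vertex            = Fin n
  ; _~_               = λ i j → ∣ toℕ i - toℕ j ∣ ≡ 1
  ; ~-sym             = λ {i} {j} e → trans (∣-∣-comm (toℕ j) (toℕ i)) e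
  ; ~-irrefl          = λ { {i} refl e → contradiction (trans (sym (∣n-n∣≡0 (toℕ i))) e) λ () }
  ; _~?_              = λ i j → ∣ toℕ i - toℕ j ∣ ℕ.≟ 1
  ; _≟_               = Fin._≟_
  ; vertices          = allFin n
  ; vertices-complete = ∈-allFin
  ; vertices-unique   = allFin⁺ n
  }

infixr 7 _□_

_□_ : Graph → Graph → Graph
G □ H = record
  { Vertex            = G.Vertex × H.Vertex
  ; _~_               = λ (a , b) (x , y) → (a ≡ x × b H.~ y) ⊎ (a G.~ x × b ≡ y)
  ; ~-sym             = λ { (inj₁ (e , q)) → inj₁ (sym e , H.~-sym q)
                          ; (inj₂ (p , e)) → inj₂ (G.~-sym p , sym e) }
  ; ~-irrefl          = λ { refl (inj₁ (_ , q)) → H.~-irrefl refl q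
                          ; refl (inj₂ (p , _)) → G.~-irrefl refl p }
  ; _~?_              = λ (a , b) (x , y) →
                          ((a G.≟ x) ×-dec (b H.~? y)) ⊎-dec ((a G.~? x) ×-dec (b H.≟ y))
  ; _≟_               = ≡-dec G._≟_ H._≟_
  ; vertices          = cartesianProduct G.vertices H.vertices
  ; vertices-complete = λ (a , b) → ∈-cartesianProduct⁺ (G.vertices-complete a) (H.vertices-complete b)
  ; vertices-unique   = cartesianProduct⁺ G.vertices-unique H.vertices-unique
  }
  where
  module G = Graph G
  module H = Graph H

grid : ℕ → ℕ → Graph
grid r s = pathGraph r □ pathGraph s

module _ {A : Set} where

  listsOfLength : List A → ℕ → List (List A)
  listsOfLength xs zero    = [] ∷ []
  listsOfLength xs (suc k) = cartesianProductWith _∷_ xs (listsOfLength xs k)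

  ∈-listsOfLength : ∀ {xs} → (∀ x → x ∈ xs) → ∀ ys → ys ∈ listsOfLength xs (length ys)
  ∈-listsOfLength complete []       = here refl
  ∈-listsOfLength complete (y ∷ ys) =
    ∈-cartesianProductWith⁺ _∷_ (complete y) (∈-listsOfLength complete ys)

  -- For a duplicate-free list: each unordered pair of distinct elements, once.
  unorderedPairs : List A → List (A × A)
  unorderedPairs []       = []
  unorderedPairs (x ∷ xs) = map (x ,_) xs ++ unorderedPairs xs

  lookup-injective : ∀ {xs : List A} → Unique xs → ∀ {i j} → lookup xs i ≡ lookup xs j → i ≡ j
  lookup-injective (_ ∷ _)  {Fin.zero}  {Fin.zero}  _ = refl
  lookup-injective (x∉ ∷ _) {Fin.zero}  {Fin.suc j} e = contradiction e (All.lookup x∉ (∈-lookup j))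
  lookup-injective (x∉ ∷ _) {Fin.suc i} {Fin.zero}  e = contradiction (sym e) (All.lookup x∉ (∈-lookup i))
  lookup-injective (_ ∷ u)  {Fin.suc i} {Fin.suc j} e = cong Fin.suc (lookup-injective u e)

  Unique⇒length≤ : ∀ {xs ys : List A} → Unique xs → (∀ x → x ∈ ys) → length xs ≤ length ys
  Unique⇒length≤ {xs} {ys} u complete = injective⇒≤ {f = λ i → index (complete (lookup xs i))}
    λ {i} {j} e → lookup-injective u
      (trans (lookup-index (complete (lookup xs i)))
        (trans (cong (lookup ys) e) (sym (lookup-index (complete (lookup xs j))))))

module _ (G : Graph) where
  open Graph G

  -- A path is given by the list of its vertices in order.
  IsPath : Vertex → Vertex → List Vertex → Set
  IsPath u v p = head p ≡ just u × last p ≡ just v × Linked _~_ p × Unique p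

  -- `length` counts vertices, one more than the number of edges.
  IsShortestPath : Vertex → Vertex → List Vertex → Set
  IsShortestPath u v p = IsPath u v p × (∀ q → IsPath u v q → length p ≤ length q)

  isPath? : ∀ u v → Unary.Decidable (IsPath u v)
  isPath? u v p = Maybe.≡-dec _≟_ (head p) (just u) ×-dec Maybe.≡-dec _≟_ (last p) (just v)
    ×-dec linked? _~?_ p ×-dec allPairs? (λ x y → ¬? (x ≟ y)) p

  -- Long enough to contain every path, since the vertices of a path are distinct.
  vertexLists : List (List Vertex)
  vertexLists = concatMap (listsOfLength vertices) (upTo (suc order))

  ∈-vertexLists : ∀ {u v p} → IsPath u v p → p ∈ vertexLists
  ∈-vertexLists {p = p} (_ , _ , _ , unique) = ∈-concatMap⁺ (listsOfLength vertices)
    (lose (∈-upTo⁺ (s≤s (Unique⇒length≤ unique vertices-complete)))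
          (∈-listsOfLength vertices-complete p))

  isShortestPath? : ∀ u v → Unary.Decidable (IsShortestPath u v)
  isShortestPath? u v p = isPath? u v p ×-dec map′
    (λ shortest q path → All.lookup shortest (∈-filter⁺ (isPath? u v) (∈-vertexLists path) path))
    (λ shortest → All.tabulate λ {q} q∈ →
      shortest q (proj₂ (∈-filter⁻ (isPath? u v) {xs = vertexLists} q∈)))
    (all? (λ q → length p ≤? length q) (filter (isPath? u v) vertexLists))

  -- The number of shortest paths from u to v.
  gpnBetween : Vertex → Vertex → ℕ
  gpnBetween u v = length (filter (isShortestPath? u v) vertexLists)

  gpn : ℕ
  gpn = sum (map (λ (u , v) → gpnBetween u v) (unorderedPairs vertices)) + order

ℕ→ℚ : ℕ → ℚ
ℕ→ℚ n = + n / 1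

{-# OPTIONS --safe #-}
-- Shortest paths between two vertices of a grid are the monotone lattice paths, so vertices whose
-- coordinates differ by i and j are joined by (i + j) C i of them. As this count is symmetric and is 1
-- on the diagonal, 2 gpn(R_{r,s}) = S + r s, where S sums it over all ordered pairs of vertices. A sum
-- D n g of g |i - j| over i, j < n satisfies D (n + 1) g + g 0 = D n g + 2 (g 0 + ... + g n); applying
-- this in both coordinates, Pascal's rule evaluates S.

module Submission where

open import Defs
open import Data.Nat as ℕ using (ℕ; zero; suc)
open import Data.Nat.Combinatorics using (_C_; nCk≡nC[n∸k]; nCn≡1; nC1≡n; nCk+nC[k+1]≡[n+1]C[k+1])
open import Data.Nat.ListAction using (sum)
open import Data.Nat.ListAction.Properties using (sum-++)
open import Data.Nat.Tactic.RingSolver using (solve-∀)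
open import Data.Fin using (Fin; zero; suc; toℕ; inject₁)
open import Data.Fin.Properties using (toℕ-injective; toℕ-inject₁)
open import Data.List using (List; []; _∷_; _++_; map; length; head; last; upTo; allFin; cartesianProduct)
open import Data.List.Properties using (map-tabulate; map-cong; map-∘; map-++; length-map; length-++;
  length-tabulate; ∷-injective; ∷-injectiveʳ)
open import Data.List.Membership.Propositional using (_∈_)
open import Data.List.Membership.Propositional.Properties using (∈-cartesianProductWith⁻; ∈-map⁺; ∈-map⁻;
  ∈-++⁺ˡ; ∈-++⁺ʳ; ∈-++⁻; ∈-filter⁺; ∈-filter⁻)
open import Data.List.Membership.Propositional.Properties.WithK using (unique∧set⇒bag)
open import Data.List.Relation.Binary.BagAndSetEquality using (∼bag⇒↭)
open import Data.List.Relation.Binary.Permutation.Propositional.Properties using (↭-length)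
open import Data.List.Relation.Unary.All as All using (All; []; _∷_)
import Data.List.Relation.Unary.All.Properties as All
open import Data.List.Relation.Unary.AllPairs as AllPairs using ([]; _∷_)
import Data.List.Relation.Unary.AllPairs.Properties as AllPairs
open import Data.List.Relation.Unary.Any using (here)
open import Data.List.Relation.Unary.Linked using (Linked; [-]; _∷_)
open import Data.List.Relation.Unary.Unique.Propositional using (Unique)
open import Data.List.Relation.Unary.Unique.Propositional.Properties using (map⁺; ++⁺; concat⁺;
  cartesianProductWith⁺; upTo⁺; filter⁺)
open import Data.Maybe using (just)
open import Data.Maybe.Properties using (just-injective)
open import Data.Product using (_×_; _,_; ∃; proj₁; proj₂; uncurry)
open import Data.Sum using (inj₁; inj₂)
open import Function using (_∘_; mk⇔)
open import Relation.Nullary using (contradiction)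
open import Relation.Binary.PropositionalEquality using (_≡_; _≢_; refl; sym; trans; cong; cong₂; subst;
  module ≡-Reasoning)

dist : ∀ {n} → Fin n → Fin n → ℕ
dist i j = ℕ.∣ toℕ i - toℕ j ∣

-- Finite sums, and the sum of binomial coefficients over all ordered pairs of grid points.

module BinomialSums where

  open import Data.Nat using (_+_; _*_; z≤n)
  open import Data.Nat.Properties using (+-identityʳ; +-suc; +-assoc; +-comm; *-distribˡ-+; +-cancelʳ-≡)
  open ≡-Reasoning

  ∑ : {A : Set} → List A → (A → ℕ) → ℕ
  ∑ xs f = sum (map f xs)

  module _ {A : Set} where

    ∑-cong : ∀ xs {f g : A → ℕ} → (∀ x → f x ≡ g x) → ∑ xs f ≡ ∑ xs g
    ∑-cong xs f≗g = cong sum (map-cong f≗g xs)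

    ∑-++ : ∀ xs ys (f : A → ℕ) → ∑ (xs ++ ys) f ≡ ∑ xs f + ∑ ys f
    ∑-++ xs ys f = trans (cong sum (map-++ f xs ys)) (sum-++ (map f xs) (map f ys))

    ∑-map : ∀ {B : Set} (g : B → A) xs (f : A → ℕ) → ∑ (map g xs) f ≡ ∑ xs (f ∘ g)
    ∑-map g xs f = cong sum (sym (map-∘ xs))

    ∑-0 : ∀ xs → ∑ {A} xs (λ _ → 0) ≡ 0
    ∑-0 []       = refl
    ∑-0 (x ∷ xs) = ∑-0 xs

    ∑-1 : ∀ xs → ∑ {A} xs (λ _ → 1) ≡ length xs
    ∑-1 []       = refl
    ∑-1 (x ∷ xs) = cong suc (∑-1 xs)

    ∑-+ : ∀ xs (f g : A → ℕ) → ∑ xs (λ x → f x + g x) ≡ ∑ xs f + ∑ xs g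
    ∑-+ []       f g = refl
    ∑-+ (x ∷ xs) f g = trans (cong (f x + g x +_) (∑-+ xs f g)) (interchange (f x) (g x) _ _)
      where
      interchange : ∀ a b c d → a + b + (c + d) ≡ a + c + (b + d)
      interchange = solve-∀

  ∑-swap : ∀ {A B : Set} xs ys (f : A → B → ℕ) →
    ∑ xs (λ x → ∑ ys (f x)) ≡ ∑ ys (λ y → ∑ xs (λ x → f x y))
  ∑-swap []       ys f = sym (∑-0 ys)
  ∑-swap (x ∷ xs) ys f = trans (cong (∑ ys (f x) +_) (∑-swap xs ys f)) (sym (∑-+ ys (f x) _))

  ∑-cartesianProduct : ∀ {A B : Set} xs ys (f : A × B → ℕ) →
    ∑ (cartesianProduct xs ys) f ≡ ∑ xs (λ x → ∑ ys (λ y → f (x , y)))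
  ∑-cartesianProduct []       ys f = refl
  ∑-cartesianProduct (x ∷ xs) ys f = begin
    ∑ (map (x ,_) ys ++ cartesianProduct xs ys) f       ≡⟨ ∑-++ (map (x ,_) ys) _ f ⟩
    ∑ (map (x ,_) ys) f + ∑ (cartesianProduct xs ys) f  ≡⟨ cong₂ _+_ (∑-map (x ,_) ys f) (∑-cartesianProduct xs ys f) ⟩
    ∑ (x ∷ xs) (λ x → ∑ ys (λ y → f (x , y)))           ∎

  -- Removing the head `x` strips one row and one column from the square of ordered pairs. By
  -- symmetry their off-diagonal parts agree, and together they are twice the pairs that
  -- `unorderedPairs` lists for `x`.
  ∑-unorderedPairs : ∀ {A : Set} xs (f : A → A → ℕ) → (∀ x y → f x y ≡ f y x) →
    ∑ xs (λ x → ∑ xs (f x)) ≡ 2 * ∑ (unorderedPairs xs) (uncurry f) + ∑ xs (λ x → f x x)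
  ∑-unorderedPairs []       f f-sym = refl
  ∑-unorderedPairs (x ∷ xs) f f-sym = begin
    f x x + ∑ xs (f x) + ∑ xs (λ y → f y x + ∑ xs (f y))
      ≡⟨ cong (f x x + ∑ xs (f x) +_) (∑-+ xs _ _) ⟩
    f x x + ∑ xs (f x) + (∑ xs (λ y → f y x) + ∑ xs (λ y → ∑ xs (f y)))
      ≡⟨ cong₂ (λ m n → f x x + ∑ xs (f x) + (m + n)) (∑-cong xs (λ y → f-sym y x)) (∑-unorderedPairs xs f f-sym) ⟩
    f x x + ∑ xs (f x) + (∑ xs (f x) + (2 * ∑ (unorderedPairs xs) (uncurry f) + ∑ xs (λ y → f y y)))
      ≡⟨ collect (f x x) _ _ _ ⟩
    2 * (∑ xs (f x) + ∑ (unorderedPairs xs) (uncurry f)) + (f x x + ∑ xs (λ y → f y y))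
      ≡⟨ cong (λ m → 2 * m + ∑ (x ∷ xs) (λ y → f y y)) (trans (∑-++ (map (x ,_) xs) _ _) (cong (_+ ∑ (unorderedPairs xs) (uncurry f)) (∑-map (x ,_) xs _))) ⟨
    2 * ∑ (unorderedPairs (x ∷ xs)) (uncurry f) + ∑ (x ∷ xs) (λ y → f y y) ∎
    where
    collect : ∀ a b c d → a + b + (b + (2 * c + d)) ≡ 2 * (b + c) + (a + d)
    collect = solve-∀

  ∑-allFin-suc : ∀ n (f : Fin (suc n) → ℕ) → ∑ (allFin (suc n)) f ≡ f zero + ∑ (allFin n) (f ∘ suc)
  ∑-allFin-suc n f = cong (λ fs → f zero + sum fs)
    (trans (map-tabulate suc f) (sym (map-tabulate (λ i → i) (f ∘ suc))))

  ∑-allFin-last : ∀ n (g : ℕ → ℕ) → ∑ (allFin (suc n)) (g ∘ toℕ) ≡ ∑ (allFin n) (g ∘ toℕ) + g n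
  ∑-allFin-last zero    g = +-identityʳ (g 0)
  ∑-allFin-last (suc n) g = begin
    ∑ (allFin (2 + n)) (g ∘ toℕ)                      ≡⟨ ∑-allFin-suc (suc n) (g ∘ toℕ) ⟩
    g 0 + ∑ (allFin (suc n)) (g ∘ suc ∘ toℕ)          ≡⟨ cong (g 0 +_) (∑-allFin-last n (g ∘ suc)) ⟩
    g 0 + (∑ (allFin n) (g ∘ suc ∘ toℕ) + g (suc n))  ≡⟨ +-assoc (g 0) _ _ ⟨
    g 0 + ∑ (allFin n) (g ∘ suc ∘ toℕ) + g (suc n)    ≡⟨ cong (_+ g (suc n)) (∑-allFin-suc n (g ∘ toℕ)) ⟨
    ∑ (allFin (suc n)) (g ∘ toℕ) + g (suc n)          ∎

  distSum : ℕ → (ℕ → ℕ) → ℕ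
  distSum n g = ∑ (allFin n) λ i → ∑ (allFin n) λ j → g (dist i j)

  -- The row and the column of index zero are peeled off; the rest is `distSum n g`, since
  -- `dist (suc i) (suc j)` reduces to `dist i j`. Row and column share their corner, so one extra
  -- `g 0` completes both to full sums.
  distSum-suc : ∀ n g → distSum (suc n) g + g 0 ≡ distSum n g + 2 * ∑ (allFin (suc n)) (g ∘ toℕ)
  distSum-suc n g = begin
    distSum (suc n) g + g 0
      ≡⟨ cong (_+ g 0) (∑-allFin-suc n _) ⟩
    R + ∑ (allFin n) (λ i → ∑ (allFin (suc n)) (λ j → g (dist (suc i) j))) + g 0
      ≡⟨ cong (λ m → R + m + g 0) (∑-cong (allFin n) (λ i → ∑-allFin-suc n _)) ⟩
    R + ∑ (allFin n) (λ i → g (suc (toℕ i)) + ∑ (allFin n) (λ j → g (dist i j))) + g 0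
      ≡⟨ cong (λ m → R + m + g 0) (∑-+ (allFin n) _ _) ⟩
    R + (R′ + distSum n g) + g 0
      ≡⟨ collect R R′ _ (g 0) ⟩
    distSum n g + (R + (g 0 + R′))
      ≡⟨ cong (λ m → distSum n g + (R + m)) (∑-allFin-suc n (g ∘ toℕ)) ⟨
    distSum n g + (R + R)
      ≡⟨ cong (λ m → distSum n g + (R + m)) (+-identityʳ R) ⟨
    distSum n g + 2 * R ∎
    where
    R  = ∑ (allFin (suc n)) (g ∘ toℕ)
    R′ = ∑ (allFin n) (g ∘ suc ∘ toℕ)
    collect : ∀ a b c d → a + (b + c) + d ≡ c + (a + (d + b))
    collect = solve-∀

  -- The number of monotone lattice paths with i steps in one direction and j in the other.
  binom : ℕ → ℕ → ℕ
  binom i j = (i + j) C i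

  binom-0ˡ : ∀ j → binom 0 j ≡ 1
  binom-0ˡ j = trans (nCk≡nC[n∸k] {n = j} z≤n) (nCn≡1 j)

  binom-0ʳ : ∀ i → binom i 0 ≡ 1
  binom-0ʳ i = trans (cong (_C i) (+-identityʳ i)) (nCn≡1 i)

  binom-1ˡ : ∀ j → binom 1 j ≡ suc j
  binom-1ˡ j = nC1≡n (suc j)

  binom-suc : ∀ i j → binom (suc i) (suc j) ≡ binom i (suc j) + binom (suc i) j
  binom-suc i j = begin
    binom (suc i) (suc j)                        ≡⟨ nCk+nC[k+1]≡[n+1]C[k+1] (i + suc j) i ⟨
    binom i (suc j) + (i + suc j) C suc i        ≡⟨ cong (λ n → binom i (suc j) + n C suc i) (+-suc i j) ⟩
    binom i (suc j) + binom (suc i) j            ∎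

  -- Evaluates the right-hand side of `distSum-binom` at `i = 0`; the factor 2 avoids a division.
  2*binom-2ˡ : ∀ j → 2 * binom 2 j ≡ (1 + j) * (2 + j)
  2*binom-2ˡ zero    = refl
  2*binom-2ˡ (suc j) = begin
    2 * binom 2 (suc j)                ≡⟨ cong (2 *_) (binom-suc 1 j) ⟩
    2 * (binom 1 (suc j) + binom 2 j)  ≡⟨ cong (λ m → 2 * (m + binom 2 j)) (binom-1ˡ (suc j)) ⟩
    2 * (2 + j + binom 2 j)            ≡⟨ *-distribˡ-+ 2 (2 + j) _ ⟩
    2 * (2 + j) + 2 * binom 2 j        ≡⟨ cong (2 * (2 + j) +_) (2*binom-2ˡ j) ⟩
    2 * (2 + j) + (1 + j) * (2 + j)    ≡⟨ expand j ⟩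
    (2 + j) * (3 + j)                  ∎
    where
    expand : ∀ j → 2 * (2 + j) + (1 + j) * (2 + j) ≡ (2 + j) * (3 + j)
    expand = solve-∀

  -- The hockey-stick identity, by repeated use of Pascal's rule.
  ∑-binom : ∀ i n → ∑ (allFin (suc n)) (binom i ∘ toℕ) ≡ binom (suc i) n
  ∑-binom i zero    = trans (+-identityʳ _) (trans (binom-0ʳ i) (sym (binom-0ʳ (suc i))))
  ∑-binom i (suc n) = begin
    ∑ (allFin (2 + n)) (binom i ∘ toℕ)                    ≡⟨ ∑-allFin-last (suc n) (binom i) ⟩
    ∑ (allFin (suc n)) (binom i ∘ toℕ) + binom i (suc n)  ≡⟨ cong (_+ binom i (suc n)) (∑-binom i n) ⟩
    binom (suc i) n + binom i (suc n)                     ≡⟨ +-comm (binom (suc i) n) _ ⟩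
    binom i (suc n) + binom (suc i) n                     ≡⟨ binom-suc i n ⟨
    binom (suc i) (suc n)                                 ∎

  -- Passing from `t` to `suc t`, `distSum-suc` and `∑-binom` contribute
  -- `2 * binom (suc i) (suc t)`, which Pascal's rule absorbs. The term `suc t` collects the values
  -- `binom i 0 = 1`, one for each index.
  distSum-binom : ∀ i t → distSum (suc t) (binom i) + suc t ≡ 2 * binom (2 + i) t
  distSum-binom i zero = begin
    binom i 0 + 0 + 0 + 1   ≡⟨ cong (λ m → m + 0 + 0 + 1) (binom-0ʳ i) ⟩
    2                       ≡⟨ cong (2 *_) (binom-0ʳ (2 + i)) ⟨
    2 * binom (2 + i) 0     ∎
  distSum-binom i (suc t) = begin
    D (2 + t) + (2 + t)                              ≡⟨ split (D (2 + t)) t ⟩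
    D (2 + t) + 1 + suc t                            ≡⟨ cong (λ m → D (2 + t) + m + suc t) (binom-0ʳ i) ⟨
    D (2 + t) + binom i 0 + suc t                    ≡⟨ cong (_+ suc t) (distSum-suc (suc t) (binom i)) ⟩
    D (suc t) + 2 * ∑ (allFin (2 + t)) (binom i ∘ toℕ) + suc t
                                                     ≡⟨ cong (λ m → D (suc t) + 2 * m + suc t) (∑-binom i (suc t)) ⟩
    D (suc t) + 2 * binom (suc i) (suc t) + suc t    ≡⟨ collect (D (suc t)) (binom (suc i) (suc t)) (suc t) ⟩
    2 * binom (suc i) (suc t) + (D (suc t) + suc t)  ≡⟨ cong (2 * binom (suc i) (suc t) +_) (distSum-binom i t) ⟩
    2 * binom (suc i) (suc t) + 2 * binom (2 + i) t  ≡⟨ *-distribˡ-+ 2 (binom (suc i) (suc t)) _ ⟨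
    2 * (binom (suc i) (suc t) + binom (2 + i) t)    ≡⟨ cong (2 *_) (binom-suc (suc i) t) ⟨
    2 * binom (2 + i) (suc t)                        ∎
    where
    D : ℕ → ℕ
    D n = distSum n (binom i)
    split : ∀ d t → d + (2 + t) ≡ d + 1 + suc t
    split = solve-∀
    collect : ∀ a b c → a + 2 * b + c ≡ 2 * b + (a + c)
    collect = solve-∀

  -- All summands are 1. The value serves as the `g 0` term when `distSum-suc` is applied in the
  -- first coordinate.
  distSum-binom-0 : ∀ t → distSum (suc t) (binom 0) ≡ suc t * suc t
  distSum-binom-0 t = +-cancelʳ-≡ (suc t) _ _ (trans (distSum-binom 0 t) (trans (2*binom-2ˡ t) (expand t)))
    where
    expand : ∀ t → (1 + t) * (2 + t) ≡ suc t * suc t + suc t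
    expand = solve-∀

  -- A second hockey-stick sum, over the values `2 * binom (2 + i) t` from `distSum-binom`. Each of
  -- the `r` summands brings its correction `suc t`, and `2 * (2 + t)` is the boundary term
  -- `2 * binom 1 (suc t)`.
  ∑-distSum-binom : ∀ r t →
    ∑ (allFin r) (λ i → distSum (suc t) (binom (toℕ i))) + (r * suc t + 2 * (2 + t)) ≡ 2 * binom (suc r) (suc t)
  ∑-distSum-binom zero    t = cong (2 *_) (sym (binom-1ˡ (suc t)))
  ∑-distSum-binom (suc r) t = begin
    ∑ (allFin (suc r)) (h ∘ toℕ) + (suc r * suc t + 2 * (2 + t))         ≡⟨ cong (_+ (suc r * suc t + 2 * (2 + t))) (∑-allFin-last r h) ⟩
    R + h r + (suc r * suc t + 2 * (2 + t))                              ≡⟨ collect R (h r) r t ⟩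
    R + (r * suc t + 2 * (2 + t)) + (h r + suc t)                        ≡⟨ cong₂ _+_ (∑-distSum-binom r t) (distSum-binom r t) ⟩
    2 * binom (suc r) (suc t) + 2 * binom (2 + r) t                      ≡⟨ *-distribˡ-+ 2 (binom (suc r) (suc t)) _ ⟨
    2 * (binom (suc r) (suc t) + binom (2 + r) t)                        ≡⟨ cong (2 *_) (binom-suc (suc r) t) ⟨
    2 * binom (2 + r) (suc t)                                            ∎
    where
    h : ℕ → ℕ
    h i = distSum (suc t) (binom i)
    R = ∑ (allFin r) (h ∘ toℕ)
    collect : ∀ a b r t → a + b + (suc r * suc t + 2 * (2 + t)) ≡ a + (r * suc t + 2 * (2 + t)) + (b + suc t)
    collect = solve-∀

  -- The correction terms of the closed form, moved to the left so that no subtraction occurs.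
  distSum-distSum-binom : ∀ r t → let s = suc t in
    distSum r (λ i → distSum s (binom i)) + (r * s * (r + s + 5) + 4 * r + 4 * s + 8) ≡ 4 * binom (suc r) (suc s)
  distSum-distSum-binom zero    t = trans (expand t) (cong (4 *_) (sym (binom-1ˡ (2 + t))))
    where
    expand : ∀ t → 4 * 0 + 4 * suc t + 8 ≡ 4 * (3 + t)
    expand = solve-∀
  distSum-distSum-binom (suc r) t = begin
    -- The increment of `P` is `s * s`, the `h 0` that `distSum-suc` asks for, plus twice the
    -- correction in `∑-distSum-binom (suc r) t`.
    S (suc r) + P (suc r)                             ≡⟨ expand (S (suc r)) r t ⟩
    S (suc r) + s * s + (P r + 2 * (suc r * s + 2 * suc s))
      ≡⟨ cong (λ m → S (suc r) + m + (P r + 2 * (suc r * s + 2 * suc s))) (distSum-binom-0 t) ⟨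
    S (suc r) + h 0 + (P r + 2 * (suc r * s + 2 * suc s))
      ≡⟨ cong (_+ (P r + 2 * (suc r * s + 2 * suc s))) (distSum-suc r h) ⟩
    S r + 2 * R + (P r + 2 * (suc r * s + 2 * suc s)) ≡⟨ collect (S r) R (P r) _ ⟩
    S r + P r + 2 * (R + (suc r * s + 2 * suc s))
      ≡⟨ cong₂ (λ m n → m + 2 * n) (distSum-distSum-binom r t) (∑-distSum-binom (suc r) t) ⟩
    4 * binom (suc r) (suc s) + 2 * (2 * binom (2 + r) s)
      ≡⟨ factor (binom (suc r) (suc s)) _ ⟩
    4 * (binom (suc r) (suc s) + binom (2 + r) s)     ≡⟨ cong (4 *_) (binom-suc (suc r) s) ⟨
    4 * binom (2 + r) (suc s)                         ∎
    where
    s = suc t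
    h : ℕ → ℕ
    h i = distSum s (binom i)
    S : ℕ → ℕ
    S n = distSum n h
    P : ℕ → ℕ
    P n = n * s * (n + s + 5) + 4 * n + 4 * s + 8
    R = ∑ (allFin (suc r)) (h ∘ toℕ)
    expand : ∀ a r t → a + (suc r * suc t * (suc r + suc t + 5) + 4 * suc r + 4 * suc t + 8) ≡
      a + suc t * suc t + ((r * suc t * (r + suc t + 5) + 4 * r + 4 * suc t + 8) + 2 * (suc r * suc t + 2 * (2 + t)))
    expand = solve-∀
    collect : ∀ a b c d → a + 2 * b + (c + 2 * d) ≡ a + c + 2 * (b + d)
    collect = solve-∀
    factor : ∀ a b → 4 * a + 2 * (2 * b) ≡ 4 * (a + b)
    factor = solve-∀

open BinomialSums

-- Enumeration of the shortest paths between two vertices of a grid.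

module Geodesics where

  open import Data.Nat using (_+_; _≤_; s≤s; s≤s⁻¹)
  open import Data.Nat.Properties

  module _ {A : Set} where

    length-listsOfLength : ∀ (xs : List A) k {ys} → ys ∈ listsOfLength xs k → length ys ≡ k
    length-listsOfLength xs zero    (here refl) = refl
    length-listsOfLength xs (suc k) ys∈
      with _ , _ , _ , zs∈ , refl ← ∈-cartesianProductWith⁻ _∷_ xs (listsOfLength xs k) ys∈
      = cong suc (length-listsOfLength xs k zs∈)

    listsOfLength-unique : ∀ {xs : List A} → Unique xs → ∀ k → Unique (listsOfLength xs k)
    listsOfLength-unique u zero    = [] ∷ []
    listsOfLength-unique u (suc k) = cartesianProductWith⁺ _∷_ ∷-injective u (listsOfLength-unique u k)

  -- Blocks with different indices are disjoint because their members differ in length. Hence the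
  -- filtered list behind `gpnBetween` contains each shortest path only once.
  vertexLists-unique : ∀ G → Unique (vertexLists G)
  vertexLists-unique G = concat⁺
    (All.map⁺ (All.universal (listsOfLength-unique vertices-unique) (upTo (suc order))))
    (AllPairs.map⁺ (AllPairs.map
      (λ {m} {n} m≢n {_} (m∈ , n∈) → m≢n
        (trans (sym (length-listsOfLength vertices m m∈)) (length-listsOfLength vertices n n∈)))
      (upTo⁺ (suc order))))
    where open Graph G

  stepTowards : ∀ {n} → Fin n → Fin n → Fin n
  -- A default for equal coordinates; the lemmas below assume a positive distance.
  stepTowards               zero    zero    = zero
  stepTowards {suc (suc n)} zero    (suc x) = suc zero
  stepTowards               (suc a) zero    = inject₁ a
  stepTowards               (suc a) (suc x) = suc (stepTowards a x)

  stepTowards-adjacent : ∀ {n p} (a x : Fin n) → dist a x ≡ suc p → dist a (stepTowards a x) ≡ 1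
  stepTowards-adjacent {suc (suc n)} zero (suc x) e = refl
  stepTowards-adjacent (suc zero)    zero    e = refl
  stepTowards-adjacent (suc (suc a)) zero    e = stepTowards-adjacent (suc a) zero refl
  stepTowards-adjacent (suc a)       (suc x) e = stepTowards-adjacent a x e

  stepTowards-closer : ∀ {n p} (a x : Fin n) → dist a x ≡ suc p → dist (stepTowards a x) x ≡ p
  stepTowards-closer {suc (suc n)} zero (suc x) e = suc-injective e
  stepTowards-closer (suc a) zero    e = trans (∣-∣-identityʳ _) (trans (toℕ-inject₁ a) (suc-injective e))
  stepTowards-closer (suc a) (suc x) e = stepTowards-closer a x e

  -- On a line only one neighbour of `a` is nearer to `x`. A shortest grid path with given ends is
  -- therefore determined by the order in which it moves in the two coordinates.
  stepTowards-unique : ∀ {n} (a a′ x : Fin n) → dist a a′ ≡ 1 → dist a x ≡ suc (dist a′ x) → a′ ≡ stepTowards a x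
  stepTowards-unique {suc (suc n)} zero (suc a′) (suc x) e f = cong suc (toℕ-injective (suc-injective e))
  stepTowards-unique (suc a)    a′       zero    e f = toℕ-injective
    (trans (sym (∣-∣-identityʳ _)) (trans (suc-injective (sym f)) (sym (toℕ-inject₁ a))))
  -- This step leads away from the target: `f` reads `toℕ x ≡ 2 + toℕ x`.
  stepTowards-unique (suc zero) zero     (suc x) e f = contradiction f (m≢1+n+m (toℕ x) {1})
  stepTowards-unique (suc a)    (suc a′) (suc x) e f = cong suc (stepTowards-unique a a′ x e f)

  dist-≤-suc : ∀ {n} (a a′ x : Fin n) → dist a a′ ≡ 1 → dist a x ≤ suc (dist a′ x)
  dist-≤-suc a a′ x e = ≤-trans (∣-∣-triangle (toℕ a) (toℕ a′) (toℕ x)) (≤-reflexive (cong (_+ dist a′ x) e))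

  module _ {r s : ℕ} where

    open Graph (grid r s) using (Vertex; _~_)

    gridDist : Vertex → Vertex → ℕ
    gridDist (a , b) (x , y) = dist a x + dist b y

    gridDist-≤-suc : ∀ {u w} v → u ~ w → gridDist u v ≤ suc (gridDist w v)
    gridDist-≤-suc {a , b} {_ , b′} (x , y) (inj₁ (refl , e)) =
      ≤-trans (+-monoʳ-≤ (dist a x) (dist-≤-suc b b′ y e)) (≤-reflexive (+-suc (dist a x) _))
    gridDist-≤-suc {a , b} {a′ , _} (x , y) (inj₂ (e , refl)) = +-monoˡ-≤ (dist b y) (dist-≤-suc a a′ x e)

    gridDist-refl : ∀ u → gridDist u u ≡ 0
    gridDist-refl (a , b) = cong₂ _+_ (∣n-n∣≡0 (toℕ a)) (∣n-n∣≡0 (toℕ b))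

    -- One edge lowers the distance to `v` by at most one. The bound is strict because `length`
    -- counts vertices, and it is stated for walks so that it applies directly to tails.
    gridDist<length : ∀ {u v} p → head p ≡ just u → last p ≡ just v → Linked _~_ p →
      suc (gridDist u v) ≤ length p
    gridDist<length {u} (u ∷ [])    refl refl _       = ≤-reflexive (cong suc (gridDist-refl u))
    gridDist<length {u} {v} (u ∷ w ∷ p) refl l (e ∷ es) =
      s≤s (≤-trans (gridDist-≤-suc v e) (gridDist<length (w ∷ p) refl l es))

    -- The shortest paths from u to v when their coordinates differ by p and q.
    geodesics : (p q : ℕ) → Vertex → Vertex → List (List Vertex)
    geodesics zero    zero    u         v         = (u ∷ []) ∷ []
    geodesics (suc p) zero    u@(a , b) v@(x , y) = map (u ∷_) (geodesics p zero (stepTowards a x , b) v)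
    geodesics zero    (suc q) u@(a , b) v@(x , y) = map (u ∷_) (geodesics zero q (a , stepTowards b y) v)
    geodesics (suc p) (suc q) u@(a , b) v@(x , y) = map (u ∷_)
      (geodesics p (suc q) (stepTowards a x , b) v ++ geodesics (suc p) q (a , stepTowards b y) v)

    -- The clauses of `geodesics` mirror the boundary values of `binom` and Pascal's rule.
    length-geodesics : ∀ p q u v → length (geodesics p q u v) ≡ binom p q
    length-geodesics zero    zero    u v = refl
    length-geodesics (suc p) zero    (a , b) v@(x , y) = trans (length-map _ (geodesics p zero _ v))
      (trans (length-geodesics p zero _ v) (trans (binom-0ʳ p) (sym (binom-0ʳ (suc p)))))
    length-geodesics zero    (suc q) (a , b) v@(x , y) = trans (length-map _ (geodesics zero q _ v))
      (trans (length-geodesics zero q _ v) (trans (binom-0ˡ q) (sym (binom-0ˡ (suc q)))))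
    length-geodesics (suc p) (suc q) (a , b) v@(x , y) = trans (length-map _ (geodesics p (suc q) _ v ++ _))
      (trans (length-++ (geodesics p (suc q) _ v))
        (trans (cong₂ _+_ (length-geodesics p (suc q) _ v) (length-geodesics (suc p) q _ v))
          (sym (binom-suc p q))))

    ∈-geodesics-fst : ∀ p q {a b x y L} → L ∈ geodesics p q (stepTowards a x , b) (x , y) →
      ((a , b) ∷ L) ∈ geodesics (suc p) q (a , b) (x , y)
    ∈-geodesics-fst p zero    L∈ = ∈-map⁺ _ L∈
    ∈-geodesics-fst p (suc q) L∈ = ∈-map⁺ _ (∈-++⁺ˡ L∈)

    ∈-geodesics-snd : ∀ p q {a b x y L} → L ∈ geodesics p q (a , stepTowards b y) (x , y) →
      ((a , b) ∷ L) ∈ geodesics p (suc q) (a , b) (x , y)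
    ∈-geodesics-snd zero    q L∈ = ∈-map⁺ _ L∈
    ∈-geodesics-snd (suc p) q L∈ = ∈-map⁺ _ (∈-++⁺ʳ (geodesics p (suc q) _ _) L∈)

    geodesics-nonempty : ∀ p q u v → ∃ (_∈ geodesics p q u v)
    geodesics-nonempty zero    zero    u v = _ , here refl
    geodesics-nonempty (suc p) q       u v = _ , ∈-geodesics-fst p q (proj₂ (geodesics-nonempty p q _ v))
    geodesics-nonempty zero    (suc q) u v = _ , ∈-geodesics-snd zero q (proj₂ (geodesics-nonempty zero q _ v))

    -- An induction principle that hides the case split on `p` and `q`: a listed path is a single
    -- vertex or begins with a step in one of the two coordinates.
    ∈-geodesics⁻ : ∀ (P : ℕ → ℕ → Vertex → Vertex → List Vertex → Set) →
      (∀ {u v} → P 0 0 u v (u ∷ [])) →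
      (∀ {p q a b x y L} → P p q (stepTowards a x , b) (x , y) L → P (suc p) q (a , b) (x , y) ((a , b) ∷ L)) →
      (∀ {p q a b x y L} → P p q (a , stepTowards b y) (x , y) L → P p (suc q) (a , b) (x , y) ((a , b) ∷ L)) →
      ∀ p q {u v L} → L ∈ geodesics p q u v → P p q u v L
    ∈-geodesics⁻ P nil fst snd zero zero (here refl) = nil
    ∈-geodesics⁻ P nil fst snd (suc p) zero L∈
      with _ , L∈′ , refl ← ∈-map⁻ _ L∈ = fst (∈-geodesics⁻ P nil fst snd p zero L∈′)
    ∈-geodesics⁻ P nil fst snd zero (suc q) L∈
      with _ , L∈′ , refl ← ∈-map⁻ _ L∈ = snd (∈-geodesics⁻ P nil fst snd zero q L∈′)
    ∈-geodesics⁻ P nil fst snd (suc p) (suc q) L∈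
      with _ , L∈′ , refl ← ∈-map⁻ _ L∈
      with ∈-++⁻ (geodesics p (suc q) _ _) L∈′
    ... | inj₁ L∈″ = fst (∈-geodesics⁻ P nil fst snd p (suc q) L∈″)
    ... | inj₂ L∈″ = snd (∈-geodesics⁻ P nil fst snd (suc p) q L∈″)

    head-geodesics : ∀ p q {u v L} → L ∈ geodesics p q u v → head L ≡ just u
    head-geodesics = ∈-geodesics⁻ (λ _ _ u _ L → head L ≡ just u) refl (λ _ → refl) (λ _ → refl)

    -- The two halves of the concatenation are disjoint: their members start at vertices with first
    -- coordinate `stepTowards a x` and `a` respectively, which are adjacent and so distinct.
    geodesics-unique : ∀ p q {u v} → dist (proj₁ u) (proj₁ v) ≡ p → dist (proj₂ u) (proj₂ v) ≡ q →
      Unique (geodesics p q u v)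
    geodesics-unique zero    zero    e f = [] ∷ []
    geodesics-unique (suc p) zero    {a , b} {x , y} e f =
      map⁺ ∷-injectiveʳ (geodesics-unique p zero (stepTowards-closer a x e) f)
    geodesics-unique zero    (suc q) {a , b} {x , y} e f =
      map⁺ ∷-injectiveʳ (geodesics-unique zero q e (stepTowards-closer b y f))
    geodesics-unique (suc p) (suc q) {a , b} {x , y} e f = map⁺ ∷-injectiveʳ
      (++⁺ (geodesics-unique p (suc q) (stepTowards-closer a x e) f)
           (geodesics-unique (suc p) q e (stepTowards-closer b y f))
           λ (L∈₁ , L∈₂) → step≢ (cong proj₁ (just-injective
             (trans (sym (head-geodesics p (suc q) L∈₁)) (head-geodesics (suc p) q L∈₂)))))
      where
      step≢ : stepTowards a x ≢ a
      step≢ eq = contradiction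
        (trans (sym (∣n-n∣≡0 (toℕ a))) (trans (cong (dist a) (sym eq)) (stepTowards-adjacent a x e))) λ ()

    record IsGeodesic (u v : Vertex) (n : ℕ) (L : List Vertex) : Set where
      constructor geodesic
      field
        isPath : IsPath (grid r s) u v L
        length≡ : length L ≡ suc n
        -- Along a geodesic the distance to the end decreases, so no vertex is repeated.
        nearby : All (λ w → gridDist w v ≤ n) L

    singleton-geodesic : ∀ {u v n} → u ≡ v → n ≡ 0 → IsGeodesic u v n (u ∷ [])
    singleton-geodesic {u} refl refl =
      geodesic (refl , refl , [-] , [] ∷ []) refl (≤-reflexive (gridDist-refl u) ∷ [])

    ∷-geodesic : ∀ {u w v n L} → u ~ w → gridDist u v ≡ suc n → IsGeodesic w v n L →
      IsGeodesic u v (suc n) (u ∷ L)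
    ∷-geodesic {u} {L = w ∷ L} e d (geodesic (refl , l , es , uniq) len near) = geodesic
      (refl , l , e ∷ es ,
        All.map (λ { {w} w≤n refl → 1+n≰n (≤-trans (≤-reflexive (sym d)) w≤n) }) near ∷ uniq)
      (cong suc len)
      (≤-reflexive d ∷ All.map m≤n⇒m≤1+n near)

    ∈-geodesics⇒geodesic : ∀ p q {u v L} → L ∈ geodesics p q u v →
      dist (proj₁ u) (proj₁ v) ≡ p → dist (proj₂ u) (proj₂ v) ≡ q → IsGeodesic u v (p + q) L
    ∈-geodesics⇒geodesic = ∈-geodesics⁻
      (λ p q u v L → dist (proj₁ u) (proj₁ v) ≡ p → dist (proj₂ u) (proj₂ v) ≡ q → IsGeodesic u v (p + q) L)
      (λ e f → singleton-geodesic
        (cong₂ _,_ (toℕ-injective (∣m-n∣≡0⇒m≡n e)) (toℕ-injective (∣m-n∣≡0⇒m≡n f))) refl)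
      (λ {a = a} {x = x} rec e f → ∷-geodesic (inj₂ (stepTowards-adjacent a x e , refl)) (cong₂ _+_ e f)
        (rec (stepTowards-closer a x e) f))
      (λ {p} {q} {a} {b} {x} {y} {L} rec e f → subst (λ n → IsGeodesic (a , b) (x , y) n ((a , b) ∷ L)) (sym (+-suc p q))
        (∷-geodesic (inj₁ (refl , stepTowards-adjacent b y f)) (trans (cong₂ _+_ e f) (+-suc p q))
          (rec e (stepTowards-closer b y f))))

    -- The length bound leaves no room for a detour. If the first edge did not bring the walk nearer
    -- to `v`, its tail would be shorter than `gridDist<length` permits; so the edge is the one
    -- given by `stepTowards-unique`, and the tail satisfies the same bound.
    ∈-geodesics⁺ : ∀ {u v} L → head L ≡ just u → last L ≡ just v → Linked _~_ L →
      ∀ {p q} → dist (proj₁ u) (proj₁ v) ≡ p → dist (proj₂ u) (proj₂ v) ≡ q → length L ≤ suc (p + q) →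
      L ∈ geodesics p q u v
    ∈-geodesics⁺ {u} (u ∷ []) refl refl _ refl refl _
      -- Both distances from `u` to itself must become literal zeros before `geodesics` can reduce.
      rewrite ∣n-n∣≡0 (toℕ (proj₁ u)) | ∣n-n∣≡0 (toℕ (proj₂ u)) = here refl
    ∈-geodesics⁺ {a , b} {x , y} (_ ∷ w@(_ , b′) ∷ L) refl l (inj₁ (refl , adj) ∷ es) {p} e f len =
      -- The index `q` is replaced by `suc (dist b′ y)`, and below `b′` by `stepTowards b y`, to
      -- match the type of `∈-geodesics-snd`.
      subst (λ q → (_ ∷ w ∷ L) ∈ geodesics p q (a , b) (x , y)) (trans (sym closer) f)
        (∈-geodesics-snd p _ (subst (λ c → (w ∷ L) ∈ geodesics p (dist b′ y) (a , c) (x , y)) (stepTowards-unique b b′ y adj closer)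
          (∈-geodesics⁺ (w ∷ L) refl l es e refl bound)))
      where
      open ≤-Reasoning
      bound : length (w ∷ L) ≤ suc (p + dist b′ y)
      bound = begin
        suc (length L)        ≤⟨ s≤s⁻¹ len ⟩
        p + _                 ≡⟨ cong (p +_) f ⟨
        p + dist b y          ≤⟨ +-monoʳ-≤ p (dist-≤-suc b b′ y adj) ⟩
        p + suc (dist b′ y)   ≡⟨ +-suc p _ ⟩
        suc (p + dist b′ y)   ∎
      closer : dist b y ≡ suc (dist b′ y)
      closer = ≤-antisym (dist-≤-suc b b′ y adj) (+-cancelˡ-≤ p _ _ (begin
        p + suc (dist b′ y)         ≡⟨ +-suc p _ ⟩
        suc (p + dist b′ y)         ≡⟨ cong (λ p → suc (p + dist b′ y)) e ⟨
        suc (dist a x + dist b′ y)  ≤⟨ gridDist<length (w ∷ L) refl l es ⟩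
        suc (length L)              ≤⟨ s≤s⁻¹ len ⟩
        p + _                       ≡⟨ cong (p +_) f ⟨
        p + dist b y                ∎))
    ∈-geodesics⁺ {a , b} {x , y} (_ ∷ w@(a′ , _) ∷ L) refl l (inj₂ (adj , refl) ∷ es) {q = q} e f len =
      subst (λ p → (_ ∷ w ∷ L) ∈ geodesics p q (a , b) (x , y)) (trans (sym closer) e)
        (∈-geodesics-fst _ q (subst (λ c → (w ∷ L) ∈ geodesics (dist a′ x) q (c , b) (x , y)) (stepTowards-unique a a′ x adj closer)
          (∈-geodesics⁺ (w ∷ L) refl l es refl f bound)))
      where
      open ≤-Reasoning
      bound : length (w ∷ L) ≤ suc (dist a′ x + q)
      bound = begin
        suc (length L)        ≤⟨ s≤s⁻¹ len ⟩
        _ + q                 ≡⟨ cong (_+ q) e ⟨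
        dist a x + q          ≤⟨ +-monoˡ-≤ q (dist-≤-suc a a′ x adj) ⟩
        suc (dist a′ x + q)   ∎
      closer : dist a x ≡ suc (dist a′ x)
      closer = ≤-antisym (dist-≤-suc a a′ x adj) (+-cancelʳ-≤ q _ _ (begin
        suc (dist a′ x + q)         ≡⟨ cong (λ q → suc (dist a′ x + q)) f ⟨
        suc (dist a′ x + dist b y)  ≤⟨ gridDist<length (w ∷ L) refl l es ⟩
        suc (length L)              ≤⟨ s≤s⁻¹ len ⟩
        _ + q                       ≡⟨ cong (_+ q) e ⟨
        dist a x + q                ∎))

    allGeodesics : Vertex → Vertex → List (List Vertex)
    allGeodesics u@(a , b) v@(x , y) = geodesics (dist a x) (dist b y) u v

    shortest⇒∈ : ∀ {u v L} → IsShortestPath (grid r s) u v L → L ∈ allGeodesics u v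
    shortest⇒∈ {u} {v} {L} ((h , l , es , _) , shortest)
      -- Minimality of `L` is tested against one listed geodesic `M`, whose known length bounds that
      -- of `L`.
      with M , M∈ ← geodesics-nonempty (dist (proj₁ u) (proj₁ v)) (dist (proj₂ u) (proj₂ v)) u v
      with geodesic path len _ ← ∈-geodesics⇒geodesic _ _ M∈ refl refl
      = ∈-geodesics⁺ L h l es refl refl (≤-trans (shortest M path) (≤-reflexive len))

    ∈⇒shortest : ∀ {u v L} → L ∈ allGeodesics u v → IsShortestPath (grid r s) u v L
    ∈⇒shortest L∈ with geodesic path len _ ← ∈-geodesics⇒geodesic _ _ L∈ refl refl
      = path , λ M (h , l , es , _) → ≤-trans (≤-reflexive len) (gridDist<length M h l es)

    -- The filtered list and `allGeodesics` have the same members and no repetitions, so they are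
    -- permutations of each other and have equal length.
    gpnBetween-grid : ∀ a b x y → gpnBetween (grid r s) (a , b) (x , y) ≡ binom (dist a x) (dist b y)
    gpnBetween-grid a b x y = trans
      (↭-length (∼bag⇒↭ (unique∧set⇒bag
        (filter⁺ shortest? (vertexLists-unique (grid r s)))
        (geodesics-unique (dist a x) (dist b y) refl refl)
        (mk⇔
          (λ L∈ → shortest⇒∈ {u} {v} (proj₂ (∈-filter⁻ shortest? {xs = vertexLists (grid r s)} L∈)))
          (λ L∈ → let shortest = ∈⇒shortest L∈ in
            ∈-filter⁺ shortest? (∈-vertexLists (grid r s) (proj₁ shortest)) shortest)))))
      (length-geodesics (dist a x) (dist b y) u v)
      where
      u v : Vertex
      u = a , b
      v = x , y
      shortest? = isShortestPath? (grid r s) u v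

open Geodesics

-- The doubled count as an identity of natural numbers.

module GridCount where

  open import Data.Nat using (_+_; _*_)
  open import Data.Nat.Properties using (+-comm; ∣n-n∣≡0; ∣-∣-comm)
  open ≡-Reasoning

  length-cartesianProduct : ∀ {A B : Set} (xs : List A) (ys : List B) →
    length (cartesianProduct xs ys) ≡ length xs * length ys
  length-cartesianProduct []       ys = refl
  length-cartesianProduct (x ∷ xs) ys = trans (length-++ (map (x ,_) ys))
    (cong₂ _+_ (length-map (x ,_) ys) (length-cartesianProduct xs ys))

  order-grid : ∀ r s → Graph.order (grid r s) ≡ r * s
  order-grid r s = trans (length-cartesianProduct (allFin r) (allFin s))
    (cong₂ _*_ (length-tabulate {n = r} (λ i → i)) (length-tabulate {n = s} (λ i → i)))

  2*gpn-grid : ∀ r s → 2 * gpn (grid r s) ≡ distSum r (λ i → distSum s (binom i)) + r * s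
  2*gpn-grid r s = begin
    2 * (∑ pairs (uncurry (gpnBetween (grid r s))) + order)
      ≡⟨ cong (λ m → 2 * (m + order)) (∑-cong pairs λ ((a , b) , (x , y)) → gpnBetween-grid a b x y) ⟩
    2 * (∑ pairs (uncurry count) + order)
      ≡⟨ collect (∑ pairs (uncurry count)) order ⟩
    2 * ∑ pairs (uncurry count) + order + order
      -- Of the two copies of `order`, one becomes the diagonal sum that completes the sum over
      -- ordered pairs; the other remains as `r * s`.
      ≡⟨ cong (λ m → 2 * ∑ pairs (uncurry count) + m + order) (trans (∑-cong vertices count-refl) (∑-1 vertices)) ⟨
    2 * ∑ pairs (uncurry count) + ∑ vertices (λ u → count u u) + order
      ≡⟨ cong (_+ order) (∑-unorderedPairs vertices count count-sym) ⟨
    ∑ vertices (λ u → ∑ vertices (count u)) + order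
      ≡⟨ cong₂ _+_ ordered (order-grid r s) ⟩
    distSum r (λ i → distSum s (binom i)) + r * s ∎
    where
    open Graph (grid r s) using (Vertex; vertices; order)
    pairs = unorderedPairs vertices
    count : Vertex → Vertex → ℕ
    count (a , b) (x , y) = binom (dist a x) (dist b y)
    count-refl : ∀ u → count u u ≡ 1
    count-refl (a , b) = cong₂ binom (∣n-n∣≡0 (toℕ a)) (∣n-n∣≡0 (toℕ b))
    count-sym : ∀ u v → count u v ≡ count v u
    count-sym (a , b) (x , y) = cong₂ binom (∣-∣-comm (toℕ a) (toℕ x)) (∣-∣-comm (toℕ b) (toℕ y))
    collect : ∀ m n → 2 * (m + n) ≡ 2 * m + n + n
    collect = solve-∀
    ordered : ∑ vertices (λ u → ∑ vertices (count u)) ≡ distSum r (λ i → distSum s (binom i))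
    ordered = trans (∑-cartesianProduct (allFin r) (allFin s) _)
      (∑-cong (allFin r) λ a → trans
        (∑-cong (allFin s) λ b → ∑-cartesianProduct (allFin r) (allFin s) (count (a , b)))
        -- The summation order `a`, `b`, `x`, `y` becomes `a`, `x`, `b`, `y`, which separates the
        -- two coordinates.
        (∑-swap (allFin s) (allFin r) _))

  -- Doubling clears the denominator of the closed form. The summand `r * s` from `2*gpn-grid` turns
  -- the factor `r + s + 4` into the `r + s + 5` of `distSum-distSum-binom`.
  gpn-grid-ℕ : ∀ r t → let s = suc t in
    2 * gpn (grid r s) + (r * s * (r + s + 4) + 4 * r + 4 * s + 8)
      ≡ 4 * ((r + s + 2) C (r + 1))
  gpn-grid-ℕ r t = begin
    2 * gpn (grid r s) + (r * s * (r + s + 4) + 4 * r + 4 * s + 8)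
      ≡⟨ cong (_+ (r * s * (r + s + 4) + 4 * r + 4 * s + 8)) (2*gpn-grid r s) ⟩
    S + r * s + (r * s * (r + s + 4) + 4 * r + 4 * s + 8)
      ≡⟨ collect S r s ⟩
    S + (r * s * (r + s + 5) + 4 * r + 4 * s + 8)
      ≡⟨ distSum-distSum-binom r t ⟩
    4 * binom (suc r) (suc s)
      ≡⟨ cong₂ (λ n k → 4 * (n C k)) (shift r s) (+-comm 1 r) ⟩
    4 * ((r + s + 2) C (r + 1)) ∎
    where
    s = suc t
    S = distSum r (λ i → distSum s (binom i))
    collect : ∀ S r s → S + r * s + (r * s * (r + s + 4) + 4 * r + 4 * s + 8) ≡
      S + (r * s * (r + s + 5) + 4 * r + 4 * s + 8)
    collect = solve-∀
    shift : ∀ r s → suc r + suc s ≡ r + s + 2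
    shift = solve-∀

open GridCount

-- Transfer of the identity to the rationals.

open import Data.Integer as ℤ using (+_)
import Data.Integer.Properties as ℤ
import Data.Integer.Tactic.RingSolver as ℤ-Ring
open import Data.Rational using (ℚ; _+_; _*_; _-_; _/_; ½; fromℚᵘ)
open import Data.Rational.Properties using (toℚᵘ-injective; toℚᵘ-fromℚᵘ; fromℚᵘ-cong; toℚᵘ-homo-+; toℚᵘ-homo-*)
open import Data.Rational.Solver using (module +-*-Solver)
open import Data.Rational.Unnormalised as ℚᵘ using (mkℚᵘ; *≡*)
import Data.Rational.Unnormalised.Properties as ℚᵘ

fromℚᵘ-homo-+ : ∀ p q → fromℚᵘ (p ℚᵘ.+ q) ≡ fromℚᵘ p + fromℚᵘ q
fromℚᵘ-homo-+ p q = toℚᵘ-injective (ℚᵘ.≃-trans (toℚᵘ-fromℚᵘ (p ℚᵘ.+ q)) (ℚᵘ.≃-sym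
  (ℚᵘ.≃-trans (toℚᵘ-homo-+ (fromℚᵘ p) (fromℚᵘ q)) (ℚᵘ.+-cong (toℚᵘ-fromℚᵘ p) (toℚᵘ-fromℚᵘ q)))))

fromℚᵘ-homo-* : ∀ p q → fromℚᵘ (p ℚᵘ.* q) ≡ fromℚᵘ p * fromℚᵘ q
fromℚᵘ-homo-* p q = toℚᵘ-injective (ℚᵘ.≃-trans (toℚᵘ-fromℚᵘ (p ℚᵘ.* q)) (ℚᵘ.≃-sym
  (ℚᵘ.≃-trans (toℚᵘ-homo-* (fromℚᵘ p) (fromℚᵘ q)) (ℚᵘ.*-cong (toℚᵘ-fromℚᵘ p) (toℚᵘ-fromℚᵘ q)))))

-- Since `ℕ→ℚ n` unfolds to `fromℚᵘ (mkℚᵘ (+ n) 0)`, the claim can be checked on unnormalised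
-- fractions, where it is an integer identity.
ℕ→ℚ-+ : ∀ m n → ℕ→ℚ (m ℕ.+ n) ≡ ℕ→ℚ m + ℕ→ℚ n
ℕ→ℚ-+ m n = trans (fromℚᵘ-cong {mkℚᵘ (+ (m ℕ.+ n)) 0} {mkℚᵘ (+ m) 0 ℚᵘ.+ mkℚᵘ (+ n) 0} (*≡* (eq (+ m) (+ n))))
  (fromℚᵘ-homo-+ (mkℚᵘ (+ m) 0) (mkℚᵘ (+ n) 0))
  where
  eq : ∀ i j → (i ℤ.+ j) ℤ.* + 1 ≡ (i ℤ.* + 1 ℤ.+ j ℤ.* + 1) ℤ.* + 1
  eq = ℤ-Ring.solve-∀

ℕ→ℚ-* : ∀ m n → ℕ→ℚ (m ℕ.* n) ≡ ℕ→ℚ m * ℕ→ℚ n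
ℕ→ℚ-* m n = trans (fromℚᵘ-cong {mkℚᵘ (+ (m ℕ.* n)) 0} {mkℚᵘ (+ m) 0 ℚᵘ.* mkℚᵘ (+ n) 0}
    (*≡* (cong (ℤ._* + 1) (ℤ.pos-* m n))))
  (fromℚᵘ-homo-* (mkℚᵘ (+ m) 0) (mkℚᵘ (+ n) 0))

-- n ↦ p is indexed by n so that Agda can infer n from a derivation, unlike from the normalising term ℕ→ℚ n.
infixl 6 _⊕_
infixl 7 _⊗_
infix 4 _↦_

data _↦_ : ℕ → ℚ → Set where
  num : ∀ n → n ↦ ℕ→ℚ n
  _⊕_ : ∀ {m n p q} → m ↦ p → n ↦ q → m ℕ.+ n ↦ p + q
  _⊗_ : ∀ {m n p q} → m ↦ p → n ↦ q → m ℕ.* n ↦ p * q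

eval : ∀ {n p} → n ↦ p → ℕ→ℚ n ≡ p
eval (num n)           = refl
eval (_⊕_ {m} {n} e f) = trans (ℕ→ℚ-+ m n) (cong₂ _+_ (eval e) (eval f))
eval (_⊗_ {m} {n} e f) = trans (ℕ→ℚ-* m n) (cong₂ _*_ (eval e) (eval f))

n/2≡n*½ : ∀ n → + n / 2 ≡ ℕ→ℚ n * ½
n/2≡n*½ n = trans (fromℚᵘ-cong {mkℚᵘ (+ n) 1} {mkℚᵘ (+ n) 0 ℚᵘ.* ℚᵘ.½}
    (*≡* (cong (ℤ._* + 2) (sym (ℤ.*-identityʳ (+ n))))))
  (fromℚᵘ-homo-* (mkℚᵘ (+ n) 0) ℚᵘ.½)

halve : ∀ g r s c →
  2 ℕ.* g ℕ.+ (r ℕ.* s ℕ.* (r ℕ.+ s ℕ.+ 4) ℕ.+ 4 ℕ.* r ℕ.+ 4 ℕ.* s ℕ.+ 8) ≡ 4 ℕ.* c →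
  ℕ→ℚ g ≡ ℕ→ℚ 2 * ℕ→ℚ c - ℕ→ℚ 2 * ℕ→ℚ r - ℕ→ℚ 2 * ℕ→ℚ s - ℕ→ℚ 4
    - (+ (r ℕ.* s) / 2) * (ℕ→ℚ r + ℕ→ℚ s + ℕ→ℚ 4)
halve g r s c eq = begin
  G
    -- Adding and removing the correction `X` produces `2ℚ * G + X`, the image of the left-hand side
    -- of `eq`.
    ≡⟨ solve 3 (λ G R S → G := con ½ :* (con 2ℚ :* G :+ correction R S) :- con ½ :* correction R S) refl G R S ⟩
  ½ * (2ℚ * G + X) - ½ * X
    ≡⟨ cong (λ p → ½ * p - ½ * X) (trans (sym cast) (trans (cong ℕ→ℚ eq) (ℕ→ℚ-* 4 c))) ⟩
  ½ * (4ℚ * C′) - ½ * X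
    ≡⟨ solve 3 (λ C R S → con ½ :* (con 4ℚ :* C) :- con ½ :* correction R S :=
         con 2ℚ :* C :- con 2ℚ :* R :- con 2ℚ :* S :- con 4ℚ :- R :* S :* con ½ :* (R :+ S :+ con 4ℚ)) refl C′ R S ⟩
  2ℚ * C′ - 2ℚ * R - 2ℚ * S - 4ℚ - R * S * ½ * (R + S + 4ℚ)
    -- The quotient `+ (r * s) / 2` is opaque to the solver, so it enters only after the polynomial
    -- identity in `R * S * ½` is settled.
    ≡⟨ cong (λ p → 2ℚ * C′ - 2ℚ * R - 2ℚ * S - 4ℚ - p * (R + S + 4ℚ))
         (trans (n/2≡n*½ (r ℕ.* s)) (cong (_* ½) (ℕ→ℚ-* r s))) ⟨
  2ℚ * C′ - 2ℚ * R - 2ℚ * S - 4ℚ - (+ (r ℕ.* s) / 2) * (R + S + 4ℚ) ∎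
  where
  open ≡-Reasoning
  open +-*-Solver
  2ℚ = ℕ→ℚ 2
  4ℚ = ℕ→ℚ 4
  8ℚ = ℕ→ℚ 8
  G = ℕ→ℚ g
  R = ℕ→ℚ r
  S = ℕ→ℚ s
  C′ = ℕ→ℚ c
  X = R * S * (R + S + 4ℚ) + 4ℚ * R + 4ℚ * S + 8ℚ
  correction : ∀ {n} → Polynomial n → Polynomial n → Polynomial n
  correction R S = R :* S :* (R :+ S :+ con 4ℚ) :+ con 4ℚ :* R :+ con 4ℚ :* S :+ con 8ℚ
  cast : ℕ→ℚ (2 ℕ.* g ℕ.+ (r ℕ.* s ℕ.* (r ℕ.+ s ℕ.+ 4) ℕ.+ 4 ℕ.* r ℕ.+ 4 ℕ.* s ℕ.+ 8)) ≡ 2ℚ * G + X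
  cast = eval (num 2 ⊗ num g ⊕
    (num r ⊗ num s ⊗ (num r ⊕ num s ⊕ num 4) ⊕ num 4 ⊗ num r ⊕ num 4 ⊗ num s ⊕ num 8))

proposition5 : ∀ (r s : ℕ) → r ℕ.≥ 1 → s ℕ.≥ 1 →
    ℕ→ℚ (gpn (grid r s)) ≡
    ℕ→ℚ 2 * ℕ→ℚ ((r ℕ.+ s ℕ.+ 2) C (r ℕ.+ 1))
    - ℕ→ℚ 2 * ℕ→ℚ r - ℕ→ℚ 2 * ℕ→ℚ s - ℕ→ℚ 4
    - (+ (r ℕ.* s) / 2) * (ℕ→ℚ r + ℕ→ℚ s + ℕ→ℚ 4)
-- The remaining case `s = 0` contradicts `s ≥ 1`.
proposition5 r s@(suc t) _ _ = halve (gpn (grid r s)) r s ((r ℕ.+ s ℕ.+ 2) C (r ℕ.+ 1)) (gpn-grid-ℕ r t)
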